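{- Let $A_1,\dots,A_k,A$ be formulas of $\mathcal{L}_\infty$ and $m_1,\dots,m_k,n$ natural numbers such that $\Box_{m_i}A_i$ ($1\le i\le k$) and $\Box_nA$ are formulas of $\mathcal{L}_\infty$. (i) If $\bigwedge_{i=1}^k\Box_{m_i}A_i\vdash_{\mathbf{K4}_h}A$ and $m_i\le n$ for all $i$, then $\bigwedge_{i=1}^k\Box_{m_i}A_i\vdash_{\mathbf{K4}_h}\Box_nA$. (ii) If $\bigwedge_{i=1}^k\Box_{m_i}A_i\vdash_{\mathbf{S4}_h}A$ and $m_i\le n$ for all $i$, then $\bigwedge_{i=1}^k\Box_{m_i}A_i\vdash_{\mathbf{S4}_h}\Box_nA$.
   Context: The language $\mathcal{L}_\infty$ consists of modal formulas built from propositional atoms, $\bot,\top$, the connectives $\neg,\wedge,\vee,\rightarrow$ and unary modalities $\Box_n$ ($n\in\mathbb{N}$), with the restriction that $\Box_n A$ is a formula only if $n$ is strictly greater than the index of every box occurring in $A$. All formulas are in $\mathcal{L}_\infty$; axiom instances are only those that are $\mathcal{L}_\infty$-formulas. Axiom schemes (for all $n\ge0$): $\mathbf{H}$: $\Box_n A\rightarrow\Box_{n+1}A$; $\mathbf{K}_h$: $\Box_n(A\rightarrow B)\rightarrow(\Box_nA\rightarrow\Box_nB)$; $\mathbf{4}_h$: $\Box_nA\rightarrow\Box_{n+1}\Box_nA$; $\mathbf{T}_h$: $\Box_nA\rightarrow A$. For a set $X$ of schemes, $L(X)$ is the least set of $\mathcal{L}_\infty$-formulas containing all classical propositional tautologies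 and all instances of the schemes in $X$, closed under modus ponens and the rule: from $A$ infer $\Box_nA$ for any $n$ greater than all box indices in $A$. $\mathbf{K4}_h=L(\mathbf{H},\mathbf{K}_h,\mathbf{4}_h)$, $\mathbf{S4}_h=L(\mathbf{H},\mathbf{K}_h,\mathbf{4}_h,\mathbf{T}_h)$. For a set $\Gamma$ of formulas, $\Gamma\vdash_{L}A$ means there is a finite $\Delta\subseteq\Gamma$ with $\bigwedge\Delta\rightarrow A\in L$. -}

module Defs where

open import Level using (0ℓ)
open import Data.Bool using (Bool; true; false; not)
import Data.Bool as Bool
open import Data.List using (List; []; _∷_; _++_; foldr)
open import Data.List.Membership.Propositional using () renaming (_∈_ to _∈ₗ_)
open import Data.List.Relation.Unary.All using (All)
open import Data.Nat using (ℕ; suc; _<_)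
open import Data.Product using (∃-syntax; _×_)
open import Relation.Binary.PropositionalEquality using (_≡_)
open import Relation.Unary using (Pred; _∈_)

infix  9 ¬_
infixr 7 _∧_
infixr 6 _∨_
infixr 5 _⇒_

-- Unrestricted formulas; the restriction on box indices is imposed by ℒ∞
-- below. The set P of propositional atoms is arbitrary.
data Formula (P : Set) : Set where
  atom        : P → Formula P
  ⊥ ⊤         : Formula P
  ¬_          : Formula P → Formula P
  _∧_ _∨_ _⇒_ : Formula P → Formula P → Formula P
  □           : ℕ → Formula P → Formula P

data Scheme : Set where
  H Kₕ 4ₕ Tₕ : Scheme

module _ {P : Set} where

  infix 4 _≻_ _IsInstanceOf_ _⊢[_]_

  boxIndices : Formula P → List ℕ
  boxIndices (atom p) = []
  boxIndices ⊥        = []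
  boxIndices ⊤        = []
  boxIndices (¬ A)    = boxIndices A
  boxIndices (A ∧ B)  = boxIndices A ++ boxIndices B
  boxIndices (A ∨ B)  = boxIndices A ++ boxIndices B
  boxIndices (A ⇒ B)  = boxIndices A ++ boxIndices B
  boxIndices (□ n A)  = n ∷ boxIndices A

  _≻_ : ℕ → Formula P → Set
  n ≻ A = All (_< n) (boxIndices A)

  data ℒ∞ : Pred (Formula P) 0ℓ where
    atom : ∀ p → ℒ∞ (atom p)
    ⊥    : ℒ∞ ⊥
    ⊤    : ℒ∞ ⊤
    ¬_   : ∀ {A} → ℒ∞ A → ℒ∞ (¬ A)
    _∧_  : ∀ {A B} → ℒ∞ A → ℒ∞ B → ℒ∞ (A ∧ B)
    _∨_  : ∀ {A B} → ℒ∞ A → ℒ∞ B → ℒ∞ (A ∨ B)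
    _⇒_  : ∀ {A B} → ℒ∞ A → ℒ∞ B → ℒ∞ (A ⇒ B)
    □    : ∀ {n A} → n ≻ A → ℒ∞ A → ℒ∞ (□ n A)

  -- Truth-table semantics in which boxed formulas are treated as further
  -- atoms: v values the atoms and w the formulas □ n A.
  eval : (v : P → Bool) (w : ℕ → Formula P → Bool) → Formula P → Bool
  eval v w (atom p) = v p
  eval v w ⊥        = false
  eval v w ⊤        = true
  eval v w (¬ A)    = not (eval v w A)
  eval v w (A ∧ B)  = eval v w A Bool.∧ eval v w B
  eval v w (A ∨ B)  = eval v w A Bool.∨ eval v w B
  eval v w (A ⇒ B)  = not (eval v w A) Bool.∨ eval v w B
  eval v w (□ n A)  = w n A

  Tautology : Pred (Formula P) 0ℓ
  Tautology A = ∀ v w → eval v w A ≡ true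

  data _IsInstanceOf_ : Formula P → Scheme → Set where
    H  : ∀ n A   → □ n A ⇒ □ (suc n) A               IsInstanceOf H
    Kₕ : ∀ n A B → □ n (A ⇒ B) ⇒ (□ n A ⇒ □ n B)     IsInstanceOf Kₕ
    4ₕ : ∀ n A   → □ n A ⇒ □ (suc n) (□ n A)         IsInstanceOf 4ₕ
    Tₕ : ∀ n A   → □ n A ⇒ A                         IsInstanceOf Tₕ

  -- Every member of L X lies in ℒ∞: this is demanded of tautologies and axiom
  -- instances, and is preserved by both rules.
  data L (X : Pred Scheme 0ℓ) : Pred (Formula P) 0ℓ where
    taut  : ∀ {A} → A ∈ ℒ∞ → Tautology A → A ∈ L X
    axiom : ∀ {A s} → A ∈ ℒ∞ → s ∈ X → A IsInstanceOf s → A ∈ L X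
    mp    : ∀ {A B} → A ⇒ B ∈ L X → A ∈ L X → B ∈ L X
    nec   : ∀ {A n} → n ≻ A → A ∈ L X → □ n A ∈ L X

  K4ₕ S4ₕ : Pred (Formula P) 0ℓ
  K4ₕ = L (_∈ₗ (H ∷ Kₕ ∷ 4ₕ ∷ []))
  S4ₕ = L (_∈ₗ (H ∷ Kₕ ∷ 4ₕ ∷ Tₕ ∷ []))

  ⋀ : List (Formula P) → Formula P
  ⋀ = foldr _∧_ ⊤

  _⊢[_]_ : Pred (Formula P) 0ℓ → Pred (Formula P) 0ℓ → Formula P → Set
  Γ ⊢[ Λ ] A = ∃[ Δ ] All (_∈ Γ) Δ × (⋀ Δ ⇒ A) ∈ Λ

{-# OPTIONS --safe #-}
-- If every mᵢ < n, then □ mᵢ Aᵢ implies □ n (□ mᵢ Aᵢ) by 4ₕ and H, and the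
-- claim is necessitation followed by Kₕ.  When some mᵢ = n, necessitation is
-- blocked, so the boxes of index ≥ n are first eliminated from the whole
-- derivation: in K4ₕ every such □ m B may be replaced by ⊤, in S4ₕ by B.  Both
-- replacements have the form c ∨ B, with c = ⊤ and c = ⊥ respectively.  They
-- fix A, and the image of □ n Aᵢ is c ∨ Aᵢ, whose n-box follows from □ n Aᵢ.
module Submission where

open import Level using (0ℓ)
open import Data.Bool using (Bool; true; false; not)
import Data.Bool as Bool
open import Data.Bool.Properties using (∨-zeroʳ)
open import Data.Fin using (Fin)
open import Data.List using (List; []; _∷_; tabulate)
open import Data.List.Relation.Unary.All as All using (All; []; _∷_)
open import Data.List.Relation.Unary.All.Properties using (++⁺; ++⁻ˡ; ++⁻ʳ; tabulate⁺)
open import Data.List.Relation.Unary.Any using (here; there)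
open import Data.Nat using (ℕ; suc; _≤_; _<?_; _≤′_; ≤′-refl; ≤′-step)
open import Data.Nat.Properties using (<-≤-trans; <-trans; <⇒≤; n<1+n; ≮⇒≥; ≤-antisym; ≤⇒≤′; ≤′⇒≤)
open import Data.Product using (_×_; _,_; proj₁; proj₂)
open import Relation.Binary.PropositionalEquality using (_≡_; refl; sym; trans; cong; cong₂; subst)
open import Relation.Nullary using (yes; no; contradiction)
open import Relation.Unary using (Pred; _∈_; ｛_｝)
open import Defs

module _ {P : Set} where

  -- Natural deduction for truth under a valuation

  infix 4 _⊨_

  Valuation : Set
  Valuation = (P → Bool) × (ℕ → Formula P → Bool)

  -- A record rather than the bare equation, so that `V` and `A` can be inferred: `eval` computes,
  -- and the formula cannot be recovered from its value.
  record _⊨_ (V : Valuation) (A : Formula P) : Set where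
    constructor holds
    field eval≡true : eval (proj₁ V) (proj₂ V) A ≡ true

  module _ {V : Valuation} where

    ⇒-intro : ∀ {A B} → (V ⊨ A → V ⊨ B) → V ⊨ A ⇒ B
    ⇒-intro {A} f with eval (proj₁ V) (proj₂ V) A in eq
    ... | false = holds (cong (λ a → not a Bool.∨ _) eq)
    ... | true  = holds (trans (cong (λ a → not a Bool.∨ _) eq) (_⊨_.eval≡true (f (holds eq))))

    ⇒-elim : ∀ {A B} → V ⊨ A ⇒ B → V ⊨ A → V ⊨ B
    ⇒-elim (holds ab) (holds a) = holds (subst (λ x → not x Bool.∨ _ ≡ true) a ab)

    ∨-introʳ : ∀ {A B} → V ⊨ B → V ⊨ A ∨ B
    ∨-introʳ (holds b) = holds (trans (cong (_ Bool.∨_) b) (∨-zeroʳ _))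

    ∨-introˡ : ∀ {A B} → V ⊨ A → V ⊨ A ∨ B
    ∨-introˡ (holds a) = holds (cong (Bool._∨ _) a)

    ∨-elim : ∀ {A B C} → (V ⊨ A → V ⊨ C) → (V ⊨ B → V ⊨ C) → V ⊨ A ∨ B → V ⊨ C
    ∨-elim {A} f g (holds ab) with eval (proj₁ V) (proj₂ V) A in eq
    ... | false = g (holds ab)
    ... | true  = f (holds eq)

    ¬-elim : ∀ {A B} → V ⊨ ¬ A → V ⊨ A → V ⊨ B
    ¬-elim (holds ¬a) (holds a) with () ← trans (sym ¬a) (cong not a)

    ⊤-intro : V ⊨ ⊤
    ⊤-intro = holds refl

    ¬⊥-intro : V ⊨ ¬ ⊥
    ¬⊥-intro = holds refl

    ∧-intro : ∀ {A B} → V ⊨ A → V ⊨ B → V ⊨ A ∧ B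
    ∧-intro (holds a) (holds b) = holds (cong₂ Bool._∧_ a b)

    ∧-elimˡ : ∀ {A B} → V ⊨ A ∧ B → V ⊨ A
    ∧-elimˡ {A} (holds ab) with true ← eval (proj₁ V) (proj₂ V) A in eq = holds eq

    ∧-elimʳ : ∀ {A B} → V ⊨ A ∧ B → V ⊨ B
    ∧-elimʳ {A} (holds ab) with true ← eval (proj₁ V) (proj₂ V) A = holds ab

  -- Well-formedness and derived rules of `L X`

  ≻-mono : ∀ {m n} {A : Formula P} → m ≤ n → m ≻ A → n ≻ A
  ≻-mono m≤n = All.map (λ i<m → <-≤-trans i<m m≤n)

  ⋀-ℒ∞ : ∀ {Ds : List (Formula P)} → All (_∈ ℒ∞) Ds → ⋀ Ds ∈ ℒ∞
  ⋀-ℒ∞ []       = ⊤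
  ⋀-ℒ∞ (d ∷ ds) = d ∧ ⋀-ℒ∞ ds

  L⊆ℒ∞ : ∀ {X} {A : Formula P} → A ∈ L X → A ∈ ℒ∞
  L⊆ℒ∞ (taut a _)    = a
  L⊆ℒ∞ (axiom a _ _) = a
  L⊆ℒ∞ (mp ab _) with L⊆ℒ∞ ab
  ... | _ ⇒ b = b
  L⊆ℒ∞ (nec n≻A a) = □ n≻A (L⊆ℒ∞ a)

  module _ {X : Pred Scheme 0ℓ} where

    valid : ∀ {A : Formula P} → A ∈ ℒ∞ → (∀ V → V ⊨ A) → A ∈ L X
    valid a ⊨A = taut a (λ v w → _⊨_.eval≡true (⊨A (v , w)))

    consequence : ∀ {A B : Formula P} → B ∈ ℒ∞ → (∀ V → V ⊨ A → V ⊨ B) → A ∈ L X → B ∈ L X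
    consequence b A⊨B a = mp (valid (L⊆ℒ∞ a ⇒ b) (λ V → ⇒-intro (A⊨B V))) a

    consequence₂ : ∀ {A B C : Formula P} → C ∈ ℒ∞ →
      (∀ V → V ⊨ A → V ⊨ B → V ⊨ C) →
      A ∈ L X → B ∈ L X → C ∈ L X
    consequence₂ c AB⊨C a b =
      mp (consequence (L⊆ℒ∞ b ⇒ c) (λ V x → ⇒-intro (AB⊨C V x)) a) b

    ⇒-trans : ∀ {A B C : Formula P} → A ⇒ B ∈ L X → B ⇒ C ∈ L X → A ⇒ C ∈ L X
    ⇒-trans p q with L⊆ℒ∞ p | L⊆ℒ∞ q
    ... | a ⇒ _ | _ ⇒ c =
      consequence₂ (a ⇒ c) (λ V x y → ⇒-intro (λ z → ⇒-elim y (⇒-elim x z))) p q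

    module _ (K∈X : Kₕ ∈ X) where

      □-mono : ∀ {n} {A B : Formula P} → n ≻ A → n ≻ B → A ⇒ B ∈ L X → □ n A ⇒ □ n B ∈ L X
      □-mono {n} {A} {B} n≻A n≻B p with L⊆ℒ∞ p
      ... | a ⇒ b = mp (axiom (□ n≻A⇒B (a ⇒ b) ⇒ (□ n≻A a ⇒ □ n≻B b)) K∈X (Kₕ n A B))
                       (nec n≻A⇒B p)
        where n≻A⇒B = ++⁺ n≻A n≻B

      □-raise : H ∈ X → ∀ {m n} {A : Formula P} → □ m A ∈ ℒ∞ → m ≤ n → □ m A ⇒ □ n A ∈ L X
      □-raise H∈X {m} {A = A} (□ m≻A a) m≤n = go (≤⇒≤′ m≤n)
        where
        go : ∀ {n} → m ≤′ n → □ m A ⇒ □ n A ∈ L X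
        go ≤′-refl = valid (□ m≻A a ⇒ □ m≻A a) (λ V → ⇒-intro (λ x → x))
        go {suc n} (≤′-step m≤′n) = ⇒-trans (go m≤′n) (axiom (□ n≻A a ⇒ □ 1+n≻A a) H∈X (H n A))
          where
          n≻A = ≻-mono {A = A} (≤′⇒≤ m≤′n) m≻A
          1+n≻A = ≻-mono {A = A} (<⇒≤ (n<1+n n)) n≻A

      □-∧ : ∀ {n} {C D A B : Formula P} → C ⇒ □ n A ∈ L X → D ⇒ □ n B ∈ L X →
        C ∧ D ⇒ □ n (A ∧ B) ∈ L X
      □-∧ {n} {C} {D} {A} {B} p q with L⊆ℒ∞ p | L⊆ℒ∞ q
      ... | c ⇒ □ n≻A a | d ⇒ □ n≻B b =
        consequence₂ ((c ∧ d) ⇒ □A∧B)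
          (λ V x y → ⇒-intro (λ z → ⇒-elim (⇒-elim x (∧-elimˡ z)) (⇒-elim y (∧-elimʳ z))))
          (⇒-trans p (⇒-trans (□-mono n≻A n≻B⇒A∧B pair) distribute)) q
        where
        n≻A∧B = ++⁺ n≻A n≻B
        n≻B⇒A∧B = ++⁺ n≻B n≻A∧B
        □A∧B : □ n (A ∧ B) ∈ ℒ∞
        □A∧B = □ n≻A∧B (a ∧ b)
        pair : A ⇒ (B ⇒ A ∧ B) ∈ L X
        pair = valid (a ⇒ (b ⇒ (a ∧ b))) (λ V → ⇒-intro (λ x → ⇒-intro (∧-intro x)))
        distribute : □ n (B ⇒ A ∧ B) ⇒ (□ n B ⇒ □ n (A ∧ B)) ∈ L X
        distribute = axiom (□ n≻B⇒A∧B (b ⇒ (a ∧ b)) ⇒ (□ n≻B b ⇒ □A∧B)) K∈X (Kₕ n B (A ∧ B))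

  -- The collapse of boxes of index at least `n`

  -- No recursion is made under a box of index below `n`: in a formula of `ℒ∞` the boxes inside it
  -- have still smaller indices.
  collapse : ℕ → Formula P → Formula P → Formula P
  collapse n c (atom p) = atom p
  collapse n c ⊥        = ⊥
  collapse n c ⊤        = ⊤
  collapse n c (¬ A)    = ¬ collapse n c A
  collapse n c (A ∧ B)  = collapse n c A ∧ collapse n c B
  collapse n c (A ∨ B)  = collapse n c A ∨ collapse n c B
  collapse n c (A ⇒ B)  = collapse n c A ⇒ collapse n c B
  collapse n c (□ m A) with m <? n
  ... | yes _ = □ m A
  ... | no  _ = c ∨ collapse n c A

  module _ (n : ℕ) (c : Formula P) where

    private
      t : Formula P → Formula P
      t = collapse n c

    collapse-fixes : ∀ A → n ≻ A → t A ≡ A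
    collapse-fixes (atom p) _ = refl
    collapse-fixes ⊥        _ = refl
    collapse-fixes ⊤        _ = refl
    collapse-fixes (¬ A)    n≻A = cong ¬_ (collapse-fixes A n≻A)
    collapse-fixes (A ∧ B)  n≻ = cong₂ _∧_ (collapse-fixes A (++⁻ˡ _ n≻)) (collapse-fixes B (++⁻ʳ (boxIndices A) n≻))
    collapse-fixes (A ∨ B)  n≻ = cong₂ _∨_ (collapse-fixes A (++⁻ˡ _ n≻)) (collapse-fixes B (++⁻ʳ (boxIndices A) n≻))
    collapse-fixes (A ⇒ B)  n≻ = cong₂ _⇒_ (collapse-fixes A (++⁻ˡ _ n≻)) (collapse-fixes B (++⁻ʳ (boxIndices A) n≻))
    collapse-fixes (□ m A)  (m<n ∷ _) with m <? n
    ... | yes _  = refl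
    ... | no m≮n = contradiction m<n m≮n

    -- Collapsing is a substitution for boxed formulas, which `eval` treats as atoms. Hence the
    -- collapse of a tautology is a tautology.
    eval-collapse : ∀ v w A → eval v w (t A) ≡ eval v (λ m B → eval v w (t (□ m B))) A
    eval-collapse v w (atom p) = refl
    eval-collapse v w ⊥        = refl
    eval-collapse v w ⊤        = refl
    eval-collapse v w (¬ A)    = cong not (eval-collapse v w A)
    eval-collapse v w (A ∧ B)  = cong₂ Bool._∧_ (eval-collapse v w A) (eval-collapse v w B)
    eval-collapse v w (A ∨ B)  = cong₂ Bool._∨_ (eval-collapse v w A) (eval-collapse v w B)
    eval-collapse v w (A ⇒ B)  = cong₂ (λ a b → not a Bool.∨ b) (eval-collapse v w A) (eval-collapse v w B)
    eval-collapse v w (□ m A)  = refl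

    module _ (n≻c : n ≻ c) (c∈ℒ∞ : c ∈ ℒ∞) where

      collapse-ℒ∞ : ∀ {A} → A ∈ ℒ∞ → t A ∈ ℒ∞
      collapse-ℒ∞ (atom p) = atom p
      collapse-ℒ∞ ⊥        = ⊥
      collapse-ℒ∞ ⊤        = ⊤
      collapse-ℒ∞ (¬ a)    = ¬ collapse-ℒ∞ a
      collapse-ℒ∞ (a ∧ b)  = collapse-ℒ∞ a ∧ collapse-ℒ∞ b
      collapse-ℒ∞ (a ∨ b)  = collapse-ℒ∞ a ∨ collapse-ℒ∞ b
      collapse-ℒ∞ (a ⇒ b)  = collapse-ℒ∞ a ⇒ collapse-ℒ∞ b
      collapse-ℒ∞ (□ {m} m≻A a) with m <? n
      ... | yes _ = □ m≻A a
      ... | no  _ = c∈ℒ∞ ∨ collapse-ℒ∞ a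

      -- This unblocks necessitation: `□ n (t A)` is a formula even if `A` has boxes of index `n` or
      -- more.
      collapse-≻ : ∀ {A} → A ∈ ℒ∞ → n ≻ t A
      collapse-≻ (atom p) = []
      collapse-≻ ⊥        = []
      collapse-≻ ⊤        = []
      collapse-≻ (¬ a)    = collapse-≻ a
      collapse-≻ (a ∧ b)  = ++⁺ (collapse-≻ a) (collapse-≻ b)
      collapse-≻ (a ∨ b)  = ++⁺ (collapse-≻ a) (collapse-≻ b)
      collapse-≻ (a ⇒ b)  = ++⁺ (collapse-≻ a) (collapse-≻ b)
      collapse-≻ (□ {m} {A} m≻A a) with m <? n
      ... | yes m<n = m<n ∷ ≻-mono {A = A} (<⇒≤ m<n) m≻A
      ... | no  _   = ++⁺ n≻c (collapse-≻ a)

      -- Collapsing derivations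

      -- The first condition on `c` is trivial for `⊤` and comes from `Tₕ` for `⊥`; the second makes
      -- `c` false as soon as `Tₕ` is present.
      module _ {X : Pred Scheme 0ℓ}
               (□⇒c∨ : ∀ {m A} → □ m A ∈ ℒ∞ → □ m A ⇒ (c ∨ A) ∈ L X)
               (T⇒¬c : Tₕ ∈ X → ∀ V → V ⊨ ¬ c) where

        collapse-axiom : ∀ {A s} → A ∈ ℒ∞ → s ∈ X → A IsInstanceOf s → t A ∈ L X
        collapse-axiom {A} a∈ s∈X inst = go a∈ s∈X inst (collapse-ℒ∞ a∈)
          where
          -- The membership `t A ∈ ℒ∞` is an argument so that its type is refined together with the
          -- goal by each comparison with `n`.
          go : ∀ {A s} → A ∈ ℒ∞ → s ∈ X → A IsInstanceOf s → t A ∈ ℒ∞ → t A ∈ L X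
          go a∈@(□A@(□ i≻A _) ⇒ _) s∈X (H i A) t∈ with i <? n | suc i <? n
          ... | yes _   | yes _ = axiom a∈ s∈X (H i A)
          -- The boundary `suc i = n`: only the consequent collapses, to `c ∨ A`.
          ... | yes i<n | no _
            rewrite collapse-fixes A (≻-mono {A = A} (<⇒≤ i<n) i≻A) = □⇒c∨ □A
          ... | no i≮n  | yes 1+i<n = contradiction (<-trans (n<1+n i) 1+i<n) i≮n
          ... | no _    | no _ = valid t∈ (λ V → ⇒-intro (λ x → x))
          go a∈ s∈X (Kₕ i A B) t∈ with i <? n
          ... | yes _ = axiom a∈ s∈X (Kₕ i A B)
          ... | no  _ = valid t∈ λ V → ⇒-intro (λ x → ⇒-intro (λ y →
            ∨-elim ∨-introˡ (λ ab → ∨-elim ∨-introˡ (λ a → ∨-introʳ (⇒-elim ab a)) y) x))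
          go a∈ s∈X (4ₕ i A) t∈ with suc i <? n
          -- The consequent is `c ∨ t (□ i A)`, a weakening of the antecedent whether or not `□ i A`
          -- itself collapses.
          ... | no _ = valid t∈ (λ V → ⇒-intro ∨-introʳ)
          ... | yes 1+i<n with i <? n
          ...   | yes _   = axiom a∈ s∈X (4ₕ i A)
          ...   | no i≮n  = contradiction (<-trans (n<1+n i) 1+i<n) i≮n
          go a∈@(□ i≻A _ ⇒ _) s∈X (Tₕ i A) t∈ with i <? n
          ... | yes i<n rewrite collapse-fixes A (≻-mono {A = A} (<⇒≤ i<n) i≻A) = axiom a∈ s∈X (Tₕ i A)
          ... | no _ = valid t∈ (λ V → ⇒-intro (∨-elim (¬-elim (T⇒¬c s∈X V)) (λ x → x)))

        collapse-L : ∀ {A} → A ∈ L X → t A ∈ L X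
        collapse-L (taut {A} a A-taut) =
          taut (collapse-ℒ∞ a) (λ v w → trans (eval-collapse v w A) (A-taut v _))
        collapse-L (axiom a∈ s∈X inst) = collapse-axiom a∈ s∈X inst
        collapse-L (mp p q) = mp (collapse-L p) (collapse-L q)
        collapse-L (nec {A} {m} m≻A p) with m <? n
        -- Here `□ m A` is unchanged, so the original derivation of `A` is reused.
        ... | yes _ = nec m≻A p
        ... | no  _ = consequence (c∈ℒ∞ ∨ L⊆ℒ∞ (collapse-L p)) (λ V → ∨-introʳ) (collapse-L p)

        -- Boxing the conclusion

        module _ (H∈X : H ∈ X) (K∈X : Kₕ ∈ X) (4∈X : 4ₕ ∈ X) where

          □⇒□collapse : ∀ {m A} → □ m A ∈ ℒ∞ → m ≤ n → □ m A ⇒ □ n (t (□ m A)) ∈ L X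
          □⇒□collapse {m} {A} □A@(□ m≻A a) m≤n with m <? n
          -- `4ₕ` gives outer index `suc m`, and `m < n` is by definition `suc m ≤ n`, the bound
          -- needed to raise it to `n`.
          ... | yes m<n = ⇒-trans (axiom (□A ⇒ □□A) 4∈X (4ₕ m A)) (□-raise K∈X H∈X □□A m<n)
            where
            □□A : □ (suc m) (□ m A) ∈ ℒ∞
            □□A = □ (n<1+n m ∷ ≻-mono {A = A} (<⇒≤ (n<1+n m)) m≻A) □A
          ... | no m≮n with refl ← ≤-antisym m≤n (≮⇒≥ m≮n) rewrite collapse-fixes A m≻A =
            □-mono K∈X m≻A (++⁺ n≻c m≻A)
              (valid (a ⇒ (c∈ℒ∞ ∨ a)) (λ V → ⇒-intro ∨-introʳ))

          -- Collapsing commutes with `⋀` by computation, so `□-∧` handles one conjunct at a time.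
          ⋀⇒□collapse⋀ : ∀ {Ds} → All (λ D → D ⇒ □ n (t D) ∈ L X) Ds → ⋀ Ds ⇒ □ n (t (⋀ Ds)) ∈ L X
          ⋀⇒□collapse⋀ [] =
            consequence (⊤ ⇒ □ [] ⊤) (λ V x → ⇒-intro (λ _ → x)) (nec {n = n} [] (valid ⊤ (λ V → ⊤-intro)))
          ⋀⇒□collapse⋀ (p ∷ ps) = □-∧ K∈X p (⋀⇒□collapse⋀ ps)

          -- Since `n ≻ A`, collapsing `G ⇒ A` gives `t G ⇒ A`, to which necessitation by `n`
          -- applies.
          □-closure : ∀ {G A} → G ⇒ □ n (t G) ∈ L X → n ≻ A → G ⇒ A ∈ L X → G ⇒ □ n A ∈ L X
          □-closure {G} {A} G⇒□tG n≻A G⇒A with L⊆ℒ∞ G⇒A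
          ... | g ⇒ _ = ⇒-trans G⇒□tG (□-mono K∈X (collapse-≻ g) n≻A
            (subst (λ B → t G ⇒ B ∈ L X) (collapse-fixes A n≻A) (collapse-L G⇒A)))

          ⊢-□-closure : ∀ {k} (As : Fin k → Formula P) (m : Fin k → ℕ) {A} →
            (∀ i → □ (m i) (As i) ∈ ℒ∞) → □ n A ∈ ℒ∞ → (∀ i → m i ≤ n) →
            ｛ ⋀ (tabulate λ i → □ (m i) (As i)) ｝ ⊢[ L X ] A →
            ｛ ⋀ (tabulate λ i → □ (m i) (As i)) ｝ ⊢[ L X ] □ n A
          ⊢-□-closure As m □As (□ n≻A a) m≤n (Δ , Δ⊆G , Δ⇒A) =
            G ∷ [] , refl ∷ [] ,
            consequence ((g ∧ ⊤) ⇒ □ n≻A a)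
              (λ V x → ⇒-intro (λ y → ⇒-elim x (∧-elimˡ y)))
              (□-closure (⋀⇒□collapse⋀ (tabulate⁺ (λ i → □⇒□collapse (□As i) (m≤n i)))) n≻A
                -- `Δ` may be empty or repeat `G`; in every case `G` entails `⋀ Δ`.
                (consequence (g ⇒ a) (λ V x → ⇒-intro (λ y → ⇒-elim x (⋀-true V Δ⊆G y))) Δ⇒A))
            where
            G = ⋀ (tabulate λ i → □ (m i) (As i))
            g : G ∈ ℒ∞
            g = ⋀-ℒ∞ (tabulate⁺ □As)
            ⋀-true : ∀ V {Δ} → All (_∈ ｛ G ｝) Δ → V ⊨ G → V ⊨ ⋀ Δ
            ⋀-true V []          x = ⊤-intro
            ⋀-true V (refl ∷ ps) x = ∧-intro x (⋀-true V ps x)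

theorem3p9 : {P : Set} (k : ℕ) (As : Fin k → Formula P) (A : Formula P) (m : Fin k → ℕ) (n : ℕ) →
    (∀ i → □ (m i) (As i) ∈ ℒ∞) → □ n A ∈ ℒ∞ →
    (｛ ⋀ (tabulate λ i → □ (m i) (As i)) ｝ ⊢[ K4ₕ ] A → (∀ i → m i ≤ n) →
    ｛ ⋀ (tabulate λ i → □ (m i) (As i)) ｝ ⊢[ K4ₕ ] □ n A)
    ×
    (｛ ⋀ (tabulate λ i → □ (m i) (As i)) ｝ ⊢[ S4ₕ ] A → (∀ i → m i ≤ n) →
    ｛ ⋀ (tabulate λ i → □ (m i) (As i)) ｝ ⊢[ S4ₕ ] □ n A)
theorem3p9 k As A m n □As □A =
    (λ ⊢A m≤n → ⊢-□-closure n ⊤ [] ⊤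
      (λ { □B@(□ _ b) → valid (□B ⇒ (⊤ ∨ b)) (λ V → ⇒-intro (λ _ → ∨-introˡ ⊤-intro)) })
      -- `Tₕ` is not among the three schemes of `K4ₕ`, so nothing has to refute `⊤`.
      (λ { (there (there (there ()))) })
      (here refl) (there (here refl)) (there (there (here refl)))
      As m □As □A m≤n ⊢A)
  , (λ ⊢A m≤n → ⊢-□-closure n ⊥ [] ⊥
      (λ { {i} {B} □B@(□ _ b) → consequence (□B ⇒ (⊥ ∨ b)) (λ V x → ⇒-intro (λ y → ∨-introʳ (⇒-elim x y)))
        (axiom (□B ⇒ b) (there (there (there (here refl)))) (Tₕ i B)) })
      (λ _ V → ¬⊥-intro)
      (here refl) (there (here refl)) (there (there (here refl)))
      As m □As □A m≤n ⊢A)
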